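{- $B$-translation is an embedding of $\mathbf{L_1}$ in the provability logic $\mathbf{PrL}$; that is, for every formula $\phi$ of $\mathbf{L_1}$, $\vdash_{\mathbf{L_1}}\phi$ if and only if $\vdash_{\mathbf{PrL}}B(\phi)$.
   Context: The system $\mathbf{L_1}$ (Leśniewski's propositional ontology): fix a countably infinite set of name variables. The atomic formulas are exactly the expressions $\epsilon ab$ with $a,b$ name variables (possibly equal); formulas are built from atomic formulas by $\vee$ and $\neg$, the other connectives being the usual classical abbreviations. $\mathbf{L_1}$ is a Hilbert-style system of classical propositional logic (with modus ponens) over these formulas with the additional axiom schemata, for all name variables $a,b,c$: (Ax1) $\epsilon ab \supset \epsilon aa$; (Ax2) $(\epsilon ab \wedge \epsilon bc) \supset \epsilon ac$; (Ax3) $(\epsilon ab \wedge \epsilon bc) \supset \epsilon ba$. $B$-translation: to each name variable $a$ corresponds a propositional variable $p_a$, with distinct name variables corresponding to distinct propositional variables. $B$ maps formulas of $\mathbf{L_1}$ to propositional modal formulas by $B(\phi\vee\psi)=B(\phi)\vee B(\psi)$, $B(\neg\phi)=\neg B(\phi)$, $B(\epsilon ab)=p_a\wedge\Box(p_a\supset p_b)\wedge\bigl(p_b\supset\Box(p_b\supset p_a)\bigr)$. $\mathbf{PrL}$ (also called $\mathbf{GL}$) is $\mathbf{K}+\Box(\Box\phi\supset\phi)\supset\Box\phi$, i.e. the smallest normal modal logic (containing $\mathbf{K}$, closed under modus ponens, substitution and necessitation) containing this schema. -}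

module Defs where

open import Data.Nat using (ℕ)

-- Classical propositional logic over any language with disjunction and
-- negation as primitives.  Since `⊃` abbreviates `¬ A ∨ B`, the schemata
-- imp-K, imp-S and contra, together with modus ponens, give the usual
-- complete calculus for `⊃` and `¬`; the three schemata for `∨` then make
-- the calculus complete for the full language.
module Classical {F : Set} (_∨_ : F → F → F) (¬_ : F → F) where

  infixr 6 _∧_
  infixr 4 _⊃_

  _⊃_ : F → F → F
  A ⊃ B = (¬ A) ∨ B

  _∧_ : F → F → F
  A ∧ B = ¬ ((¬ A) ∨ (¬ B))

  data Axiom : F → Set where
    imp-K  : ∀ A B   → Axiom (A ⊃ B ⊃ A)
    imp-S  : ∀ A B C → Axiom ((A ⊃ B ⊃ C) ⊃ (A ⊃ B) ⊃ A ⊃ C)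
    contra : ∀ A B   → Axiom ((¬ A ⊃ ¬ B) ⊃ B ⊃ A)
    or-I₁  : ∀ A B   → Axiom (A ⊃ (A ∨ B))
    or-I₂  : ∀ A B   → Axiom (B ⊃ (A ∨ B))
    or-E   : ∀ A B C → Axiom ((A ⊃ C) ⊃ (B ⊃ C) ⊃ (A ∨ B) ⊃ C)

NameVar : Set
NameVar = ℕ

PropVar : Set
PropVar = ℕ

module L₁ where

  infix  8 ¬_
  infixr 5 _∨_

  data Formula : Set where
    ε   : NameVar → NameVar → Formula
    _∨_ : Formula → Formula → Formula
    ¬_  : Formula → Formula

  open Classical _∨_ ¬_ public

  infix 2 ⊢_

  data ⊢_ : Formula → Set where
    classical : ∀ {φ} → Axiom φ → ⊢ φ
    ax1 : ∀ a b   → ⊢ ε a b ⊃ ε a a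
    ax2 : ∀ a b c → ⊢ ε a b ∧ ε b c ⊃ ε a c
    ax3 : ∀ a b c → ⊢ ε a b ∧ ε b c ⊃ ε b a
    mp  : ∀ {φ ψ} → ⊢ φ ⊃ ψ → ⊢ φ → ⊢ ψ

module Modal where

  infix  8 ¬_ □_
  infixr 5 _∨_

  data Formula : Set where
    var : PropVar → Formula
    _∨_ : Formula → Formula → Formula
    ¬_  : Formula → Formula
    □_  : Formula → Formula

  open Classical _∨_ ¬_ public

  _[_] : Formula → (PropVar → Formula) → Formula
  var q   [ σ ] = σ q
  (φ ∨ ψ) [ σ ] = (φ [ σ ]) ∨ (ψ [ σ ])
  (¬ φ)   [ σ ] = ¬ (φ [ σ ])
  (□ φ)   [ σ ] = □ (φ [ σ ])

  -- `K+ X` is the smallest normal modal logic containing every formula in X.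
  data K+ (X : Formula → Set) : Formula → Set where
    classical : ∀ {φ} → Axiom φ → K+ X φ
    distr     : ∀ φ ψ → K+ X (□ (φ ⊃ ψ) ⊃ □ φ ⊃ □ ψ)
    extra     : ∀ {φ} → X φ → K+ X φ
    mp        : ∀ {φ ψ} → K+ X (φ ⊃ ψ) → K+ X φ → K+ X ψ
    nec       : ∀ {φ} → K+ X φ → K+ X (□ φ)
    subst     : ∀ {φ} (σ : PropVar → Formula) → K+ X φ → K+ X (φ [ σ ])

  data Löb : Formula → Set where
    löb : ∀ φ → Löb (□ (□ φ ⊃ φ) ⊃ □ φ)

module PrL where

  infix 2 ⊢_

  ⊢_ : Modal.Formula → Set
  ⊢ φ = Modal.K+ Modal.Löb φ

-- The argument p sends a name variable a to its propositional variable p_a.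
B : (NameVar → PropVar) → L₁.Formula → Modal.Formula
B p (L₁.ε a b)   = pa ∧ □ (pa ⊃ pb) ∧ (pb ⊃ □ (pb ⊃ pa))
  where
  open Modal
  pa pb : Formula
  pa = var (p a)
  pb = var (p b)
B p (φ L₁.∨ ψ) = B p φ Modal.∨ B p ψ
B p (L₁.¬ φ)   = Modal.¬ B p φ

{-# OPTIONS --safe #-}
module Submission where

open import Data.Bool using (Bool; true; false; not; T) renaming (_∨_ to _∨ᵇ_; _∧_ to _∧ᵇ_)
open import Data.Bool.ListAction using (all)
open import Data.Bool.Properties using (T-≡)
open import Data.Empty using (⊥-elim)
open import Data.List using (List; []; _∷_; _++_; map; foldr; cartesianProduct)
open import Data.List.Membership.Propositional using (_∈_; find; lose)
open import Data.List.Membership.Propositional.Properties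
  using (∈-++⁺ˡ; ∈-++⁺ʳ; ∈-map⁺; ∈-cartesianProduct⁺)
open import Data.List.Relation.Binary.Subset.Propositional using (_⊆_)
open import Data.List.Relation.Unary.All as All using (All; []; _∷_)
import Data.List.Relation.Unary.All.Properties as All
open import Data.List.Relation.Unary.Any using (here; there; any?)
open import Data.Nat using (_≟_)
open import Data.Product using (_×_; _,_; proj₁; proj₂; ∃-syntax; map₁)
open import Data.Product.Properties using (≡-dec)
open import Data.Sum using (_⊎_; inj₁; inj₂)
open import Data.Unit using (tt)
open import Function using (_∘_; id; case_of_)
open import Function.Bundles using (_⇔_; mk⇔; module Equivalence)
open import Function.Definitions using (Injective)
open import Relation.Binary.PropositionalEquality
  using (_≡_; refl; sym; trans; cong; cong₂; subst)
open import Relation.Nullary using (Dec; yes; no; contradiction)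
open import Defs

-- The axioms of L₁ translate to theorems of K.  For the converse, Kalmár's
-- argument either proves φ or produces a Boolean relation v on the names of φ
-- that satisfies Ax1–Ax3 and refutes φ.  Such a v is realised by a Kripke model
-- of height two: p_a holds at the root iff v a a, and every name c of φ
-- contributes a dead end at which p_b holds iff v c b.  The frame is transitive
-- and conversely well-founded, hence validates PrL, and at its root B(ε a b)
-- is true exactly when v a b.

-- Derivations from hypotheses over a classical Hilbert calculus, shared by both logics.

module Hilbert {F : Set} (_∨_ : F → F → F) (¬_ : F → F) (⊢_ : F → Set)
  (axiom : ∀ {A} → Classical.Axiom _∨_ ¬_ A → ⊢ A)
  (mp : ∀ {A B} → ⊢ (Classical._⊃_ _∨_ ¬_ A B) → ⊢ A → ⊢ B)
  where

  open Classical _∨_ ¬_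

  infix  2 _⊩_
  infixl 9 _·_

  -- Modus ponens is the only rule that acts under hypotheses. Necessitation enters through `thm`
  -- alone, which keeps the deduction theorem valid for modal logics.
  data _⊩_ (Γ : List F) : F → Set where
    hyp : ∀ {A} → A ∈ Γ → Γ ⊩ A
    thm : ∀ {A} → ⊢ A → Γ ⊩ A
    _·_ : ∀ {A B} → Γ ⊩ A ⊃ B → Γ ⊩ A → Γ ⊩ B

  pattern #0 = hyp (here refl)
  pattern #1 = hyp (there (here refl))
  pattern #2 = hyp (there (there (here refl)))

  ax : ∀ {Γ A} → Axiom A → Γ ⊩ A
  ax α = thm (axiom α)

  close : ∀ {A} → [] ⊩ A → ⊢ A
  close (thm t) = t
  close (d · e) = mp (close d) (close e)

  weaken : ∀ {Γ Δ A} → Γ ⊆ Δ → Γ ⊩ A → Δ ⊩ A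
  weaken s (hyp x) = hyp (s x)
  weaken s (thm t) = thm t
  weaken s (d · e) = weaken s d · weaken s e

  deduction : ∀ {Γ A B} → A ∷ Γ ⊩ B → Γ ⊩ A ⊃ B
  deduction {A = A} #0 = ax (imp-S A (A ⊃ A) A) · ax (imp-K A (A ⊃ A)) · ax (imp-K A A)
  deduction (hyp (there x)) = ax (imp-K _ _) · hyp x
  deduction (thm t) = ax (imp-K _ _) · thm t
  deduction (d · e) = ax (imp-S _ _ _) · deduction d · deduction e

  ⊃-trans : ∀ {Γ A B C} → Γ ⊩ (A ⊃ B) ⊃ (B ⊃ C) ⊃ A ⊃ C
  ⊃-trans = deduction (deduction (deduction (#1 · (#2 · #0))))

  explosion : ∀ {Γ A B} → Γ ⊩ ¬ A → Γ ⊩ A → Γ ⊩ B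
  explosion d e = ax (contra _ _) · (ax (imp-K _ _) · d) · e

  ∨-elim : ∀ {Γ A B C} → A ∷ Γ ⊩ C → B ∷ Γ ⊩ C → Γ ⊩ A ∨ B → Γ ⊩ C
  ∨-elim d e f = ax (or-E _ _ _) · deduction d · deduction e · f

  -- A ⊃ A is literally the excluded middle ¬ A ∨ A.
  cases : ∀ {Γ} A {C} → A ∷ Γ ⊩ C → ¬ A ∷ Γ ⊩ C → Γ ⊩ C
  cases A d e = ∨-elim e d (deduction (hyp {A = A} (here refl)))

  -- With no falsum in the language, refuting `A` means deriving `¬ A` from it. Excluded middle then
  -- finishes, its other case being the goal itself.
  ¬-intro : ∀ {Γ A} → A ∷ Γ ⊩ ¬ A → Γ ⊩ ¬ A
  ¬-intro d = cases _ d #0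

  ∧-intro : ∀ {Γ A B} → Γ ⊩ A → Γ ⊩ B → Γ ⊩ A ∧ B
  ∧-intro d e = ¬-intro (∨-elim (explosion #0 (weaken (there ∘ there) d))
                                (explosion #0 (weaken (there ∘ there) e)) #0)

  ∧-elim₁ : ∀ {Γ A B} → Γ ⊩ A ∧ B → Γ ⊩ A
  ∧-elim₁ d = cases _ #0 (explosion (weaken there d) (ax (or-I₁ _ _) · #0))

  ∧-elim₂ : ∀ {Γ A B} → Γ ⊩ A ∧ B → Γ ⊩ B
  ∧-elim₂ d = cases _ #0 (explosion (weaken there d) (ax (or-I₂ _ _) · #0))

-- From theorems of the ontology to theorems of any normal modal logic.

module Translation {X : Modal.Formula → Set} (p : NameVar → PropVar) where

  open Modal
  open Hilbert _∨_ ¬_ (K+ X) classical mp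

  □-trans : ∀ {Γ A B C} → Γ ⊩ □ (A ⊃ B) → Γ ⊩ □ (B ⊃ C) → Γ ⊩ □ (A ⊃ C)
  □-trans d e = thm (distr _ _) · (thm (distr _ _) · thm (nec (close ⊃-trans)) · d) · e

  B-ε : NameVar → NameVar → Formula
  B-ε a b = B p (L₁.ε a b)

  module _ {Γ a b} (d : Γ ⊩ B-ε a b) where

    subject : Γ ⊩ var (p a)
    subject = ∧-elim₁ d

    inclusion : Γ ⊩ □ (var (p a) ⊃ var (p b))
    inclusion = ∧-elim₁ (∧-elim₂ d)

    converse : Γ ⊩ var (p b) ⊃ □ (var (p b) ⊃ var (p a))
    converse = ∧-elim₂ (∧-elim₂ d)

  B-ax1 : ∀ a b → K+ X (B-ε a b ⊃ B-ε a a)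
  B-ax1 a b = close (deduction (∧-intro (subject #0) (∧-intro refl-□ (deduction refl-□))))
    where
    refl-□ : ∀ {Γ} → Γ ⊩ □ (var (p a) ⊃ var (p a))
    refl-□ = thm (nec (close (deduction #0)))

  -- The inclusions compose. Backwards, p_c yields □(p_c ⊃ p_b), while p_b, the subject of the
  -- second premise, yields □(p_b ⊃ p_a).
  B-ax2 : ∀ a b c → K+ X (B-ε a b ∧ B-ε b c ⊃ B-ε a c)
  B-ax2 a b c = close (deduction (∧-intro (subject ab)
    (∧-intro (□-trans (inclusion ab) (inclusion bc))
             (deduction (□-trans (weaken there (converse bc) · #0)
                                 (weaken there (converse ab · subject bc)))))))
    where
    ab = ∧-elim₁ #0
    bc = ∧-elim₂ #0

  -- The two boxed clauses of ε a b swap roles: its converse clause, triggered by p_b, is the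
  -- inclusion sought, and its inclusion gives the new converse clause.
  B-ax3 : ∀ a b c → K+ X (B-ε a b ∧ B-ε b c ⊃ B-ε b a)
  B-ax3 a b c = close (deduction (∧-intro (subject bc)
    (∧-intro (converse ab · subject bc) (deduction (weaken there (inclusion ab))))))
    where
    ab = ∧-elim₁ #0
    bc = ∧-elim₂ #0

  B-axiom : ∀ {φ} → L₁.Axiom φ → Axiom (B p φ)
  B-axiom (L₁.imp-K _ _)   = imp-K _ _
  B-axiom (L₁.imp-S _ _ _) = imp-S _ _ _
  B-axiom (L₁.contra _ _)  = contra _ _
  B-axiom (L₁.or-I₁ _ _)   = or-I₁ _ _
  B-axiom (L₁.or-I₂ _ _)   = or-I₂ _ _
  B-axiom (L₁.or-E _ _ _)  = or-E _ _ _

  B-preserves-⊢ : ∀ {φ} → L₁.⊢ φ → K+ X (B p φ)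
  B-preserves-⊢ (L₁.classical α) = classical (B-axiom α)
  B-preserves-⊢ (L₁.ax1 a b)     = B-ax1 a b
  B-preserves-⊢ (L₁.ax2 a b c)   = B-ax2 a b c
  B-preserves-⊢ (L₁.ax3 a b c)   = B-ax3 a b c
  B-preserves-⊢ (L₁.mp d e)      = mp (B-preserves-⊢ d) (B-preserves-⊢ e)

T-⊃-intro : ∀ {x y} → (T x → T y) → T (not x ∨ᵇ y)
T-⊃-intro {true}  f = f tt
T-⊃-intro {false} f = tt

T-⊃-elim : ∀ {x y} → T (not x ∨ᵇ y) → T x → T y
T-⊃-elim {true} t _ = t

T-∧-intro : ∀ {x y} → T x → T y → T (not (not x ∨ᵇ not y))
T-∧-intro {true} {true} _ _ = tt

T-∧-elim : ∀ {x y} → T (not (not x ∨ᵇ not y)) → T x × T y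
T-∧-elim {true} {true} _ = tt , tt

T-⇔⇒≡ : ∀ {x y} → (T x → T y) → (T y → T x) → x ≡ y
T-⇔⇒≡ {true}  {true}  f g = refl
T-⇔⇒≡ {true}  {false} f g = ⊥-elim (f tt)
T-⇔⇒≡ {false} {true}  f g = ⊥-elim (g tt)
T-⇔⇒≡ {false} {false} f g = refl

-- Soundness of provability logic for models of height two.

module Kripke where

  open Modal hiding (subst)

  Valuation : Set
  Valuation = PropVar → Bool

  -- Truth at the root, with valuation ρ, of the frame whose other worlds are
  -- dead ends with the valuations vs; a dead end is itself the root for vs = [].
  eval : List Valuation → Valuation → Formula → Bool
  eval vs ρ (var q)  = ρ q
  eval vs ρ (φ ∨ ψ) = eval vs ρ φ ∨ᵇ eval vs ρ ψ
  eval vs ρ (¬ φ)    = not (eval vs ρ φ)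
  eval vs ρ (□ φ)    = all (λ ρ′ → eval [] ρ′ φ) vs

  Valid : Formula → Set
  Valid φ = ∀ vs ρ → T (eval vs ρ φ)

  axiom-valid : ∀ {φ} → Axiom φ → Valid φ
  axiom-valid (imp-K A B) vs ρ with eval vs ρ A | eval vs ρ B
  ... | true  | true  = tt
  ... | true  | false = tt
  ... | false | _     = tt
  axiom-valid (imp-S A B C) vs ρ with eval vs ρ A | eval vs ρ B | eval vs ρ C
  ... | true  | true  | true  = tt
  ... | true  | true  | false = tt
  ... | true  | false | _     = tt
  ... | false | _     | _     = tt
  axiom-valid (contra A B) vs ρ with eval vs ρ A | eval vs ρ B
  ... | true  | true  = tt
  ... | true  | false = tt
  ... | false | true  = tt
  ... | false | false = tt
  axiom-valid (or-I₁ A B) vs ρ with eval vs ρ A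
  ... | true  = tt
  ... | false = tt
  axiom-valid (or-I₂ A B) vs ρ with eval vs ρ A | eval vs ρ B
  ... | true  | true  = tt
  ... | false | true  = tt
  ... | _     | false = tt
  axiom-valid (or-E A B C) vs ρ with eval vs ρ A | eval vs ρ B | eval vs ρ C
  ... | true  | _     | false = tt
  ... | true  | true  | true  = tt
  ... | true  | false | true  = tt
  ... | false | true  | true  = tt
  ... | false | true  | false = tt
  ... | false | false | _     = tt

  -- Substitution is absorbed into the valuation of every world. Since validity ranges over all
  -- roots and all lists of dead ends, it is closed under substitution.
  eval-[] : ∀ (σ : PropVar → Formula) vs ρ φ →
    eval vs ρ (φ [ σ ]) ≡
    eval (map (λ ρ′ q → eval [] ρ′ (σ q)) vs) (λ q → eval vs ρ (σ q)) φ
  eval-[] σ vs ρ (var q)  = refl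
  eval-[] σ vs ρ (φ ∨ ψ) = cong₂ _∨ᵇ_ (eval-[] σ vs ρ φ) (eval-[] σ vs ρ ψ)
  eval-[] σ vs ρ (¬ φ)    = cong not (eval-[] σ vs ρ φ)
  eval-[] σ []        ρ (□ φ) = refl
  -- The first dead end recurses on the smaller formula; the remaining ones keep `□ φ` and shorten
  -- the list.
  eval-[] σ (ρ′ ∷ vs) ρ (□ φ) = cong₂ _∧ᵇ_ (eval-[] σ [] ρ′ φ) (eval-[] σ vs ρ (□ φ))

  sound : ∀ {φ} → PrL.⊢ φ → Valid φ
  sound (classical α) vs ρ = axiom-valid α vs ρ
  sound (distr φ ψ) vs ρ = T-⊃-intro λ t → T-⊃-intro λ u →
    All.all⁻ _ (All.zipWith (λ (x , y) → T-⊃-elim x y) (All.all⁺ _ vs t , All.all⁺ _ vs u))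
  -- At a dead end □ φ is true, so there □ φ ⊃ φ evaluates to the value of φ.
  sound (extra (löb φ)) vs ρ = T-⊃-intro {eval vs ρ (□ φ)} id
  sound (mp d e) vs ρ = T-⊃-elim (sound d vs ρ) (sound e vs ρ)
  sound (nec d) vs ρ = All.all⁻ _ (All.universal (sound d []) vs)
  sound (K+.subst {φ} σ d) vs ρ rewrite eval-[] σ vs ρ φ = sound d _ _

-- Deciding provability by truth tables, relative to finitely many axiom instances.

module Kalmár where

  open L₁
  open Hilbert _∨_ ¬_ ⊢_ classical mp

  Atom : Set
  Atom = NameVar × NameVar

  ⟨_⟩ : Atom → Formula
  ⟨ a , b ⟩ = ε a b

  atoms : Formula → List Atom
  atoms (ε a b) = (a , b) ∷ []
  atoms (φ ∨ ψ) = atoms φ ++ atoms ψ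
  atoms (¬ φ)    = atoms φ

  Valuation : Set
  Valuation = Atom → Bool

  eval : Valuation → Formula → Bool
  eval v (ε a b)  = v (a , b)
  eval v (φ ∨ ψ) = eval v φ ∨ᵇ eval v ψ
  eval v (¬ φ)    = not (eval v φ)

  literal : Formula → Bool → Formula
  literal φ true  = φ
  literal φ false = ¬ φ

  literal-∨ : ∀ {Γ φ ψ} x y → Γ ⊩ literal φ x → Γ ⊩ literal ψ y → Γ ⊩ literal (φ ∨ ψ) (x ∨ᵇ y)
  literal-∨ true  _     d e = ax (or-I₁ _ _) · d
  literal-∨ false true  d e = ax (or-I₂ _ _) · e
  literal-∨ false false d e = ¬-intro (∨-elim (explosion (weaken (there ∘ there) d) #0)
                                              (explosion (weaken (there ∘ there) e) #0) #0)

  literal-¬ : ∀ {Γ φ} x → Γ ⊩ literal φ x → Γ ⊩ literal (¬ φ) (not x)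
  literal-¬ true  d = ¬-intro (explosion #0 (weaken there d))
  literal-¬ false d = d

  _Decides_ : List Formula → Valuation → Atom → Set
  (Γ Decides v) x = Γ ⊩ literal ⟨ x ⟩ (v x)

  -- Kalmár's lemma: the signs of the atoms propagate through the connectives by `literal-∨` and
  -- `literal-¬`.
  decides-eval : ∀ {Γ v} φ → (∀ {x} → x ∈ atoms φ → (Γ Decides v) x) → Γ ⊩ literal φ (eval v φ)
  decides-eval (ε a b)  h = h (here refl)
  decides-eval (φ ∨ ψ) h =
    literal-∨ _ _ (decides-eval φ (h ∘ ∈-++⁺ˡ)) (decides-eval ψ (h ∘ ∈-++⁺ʳ (atoms φ)))
  decides-eval (¬ φ)    h = literal-¬ _ (decides-eval φ h)

  _≟ᴬ_ : (x y : Atom) → Dec (x ≡ y)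
  _≟ᴬ_ = ≡-dec _≟_ _≟_

  update : Valuation → Atom → Bool → Valuation
  update v x t y with y ≟ᴬ x
  ... | yes _ = t
  ... | no  _ = v y

  module _ (φ : Formula) where

    Refutable : Set
    Refutable = ∃[ v ] eval v φ ≡ false

    -- `xs` holds the atoms still to be branched on and `Γ` the literals chosen so far. Once `xs` is
    -- exhausted, `Γ` derives `φ` or `v` refutes it; derivations from both signs of an atom merge by
    -- excluded middle.
    search : ∀ xs Γ v → (∀ {y} → y ∈ atoms φ → y ∈ xs ⊎ (Γ Decides v) y) → (Γ ⊩ φ) ⊎ Refutable
    search [] Γ v h with eval v φ in eq | decides-eval φ (λ m → case h m of λ { (inj₂ d) → d })
    ... | true  | d = inj₁ d
    ... | false | _ = inj₂ (v , eq)
    search (x ∷ xs) Γ v h = case branch true , branch false of λ where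
        (inj₁ d , inj₁ e) → inj₁ (cases ⟨ x ⟩ d e)
        (inj₂ r , _)      → inj₂ r
        (_      , inj₂ r) → inj₂ r
      where
      branch : ∀ t → (literal ⟨ x ⟩ t ∷ Γ ⊩ φ) ⊎ Refutable
      branch t = search xs (literal ⟨ x ⟩ t ∷ Γ) (update v x t) h′
        where
        h′ : ∀ {y} → y ∈ atoms φ → y ∈ xs ⊎ ((literal ⟨ x ⟩ t ∷ Γ) Decides update v x t) y
        h′ {y} m with y ≟ᴬ x | h m
        -- A repeated atom is branched on again; the newest literal agrees with the updated
        -- valuation whatever `Γ` already contains.
        ... | yes refl | _                = inj₂ #0
        ... | no y≢x   | inj₁ (here y≡x)  = contradiction y≡x y≢x
        ... | no _     | inj₁ (there m′)  = inj₁ m′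
        ... | no _     | inj₂ d           = inj₂ (weaken there d)

    ⊢⊎refutable : (⊢ φ) ⊎ Refutable
    -- The starting valuation is arbitrary, since every atom of `φ` is still to be assigned.
    ⊢⊎refutable with search (atoms φ) [] (λ _ → false) inj₁
    ... | inj₁ d = inj₁ (close d)
    ... | inj₂ r = inj₂ r

  _⇛_ : List Formula → Formula → Formula
  Θ ⇛ φ = foldr _⊃_ φ Θ

  ⇛-elim : ∀ {Θ φ} → All ⊢_ Θ → ⊢ Θ ⇛ φ → ⊢ φ
  ⇛-elim []       d = d
  ⇛-elim (t ∷ ts) d = ⇛-elim ts (mp d t)

  ⇛-false : ∀ {v φ} Θ → eval v (Θ ⇛ φ) ≡ false → All (T ∘ eval v) Θ × eval v φ ≡ false
  ⇛-false         []      eq = [] , eq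
  ⇛-false {v} {φ} (θ ∷ Θ) eq with eval v θ in t
  ... | true = map₁ (Equivalence.from T-≡ t ∷_) (⇛-false Θ eq)

  -- The dichotomy is applied to `Θ ⇛ φ`: modus ponens discharges the provable premises, and a
  -- refutation must make every premise true.
  ⊢⊎refutable-in : ∀ {Θ} φ → All ⊢_ Θ →
    (⊢ φ) ⊎ (∃[ v ] All (T ∘ eval v) Θ × eval v φ ≡ false)
  ⊢⊎refutable-in {Θ} φ ts with ⊢⊎refutable (Θ ⇛ φ)
  ... | inj₁ d        = inj₁ (⇛-elim ts d)
  ... | inj₂ (v , eq) = inj₂ (v , ⇛-false Θ eq)

  -- The conditions are confined to `N` because only finitely many axiom instances can serve as
  -- premises of a formula.
  record Ontological (N : List NameVar) (v : Valuation) : Set where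
    field
      ax1-true : ∀ {a b} → a ∈ N → b ∈ N → T (v (a , b)) → T (v (a , a))
      ax2-true : ∀ {a b c} → a ∈ N → b ∈ N → c ∈ N →
                 T (v (a , b)) → T (v (b , c)) → T (v (a , c))
      ax3-true : ∀ {a b c} → a ∈ N → b ∈ N → c ∈ N →
                 T (v (a , b)) → T (v (b , c)) → T (v (b , a))

  Ax1 : NameVar × NameVar → Formula
  Ax1 (a , b) = ε a b ⊃ ε a a

  Ax2 Ax3 : NameVar × NameVar × NameVar → Formula
  Ax2 (a , b , c) = ε a b ∧ ε b c ⊃ ε a c
  Ax3 (a , b , c) = ε a b ∧ ε b c ⊃ ε b a

  module _ (N : List NameVar) where

    pairs : List (NameVar × NameVar)
    pairs = cartesianProduct N N

    triples : List (NameVar × NameVar × NameVar)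
    triples = cartesianProduct N pairs

    instances : List Formula
    instances = map Ax1 pairs ++ map Ax2 triples ++ map Ax3 triples

    instances-provable : All ⊢_ instances
    instances-provable =
      All.++⁺ (All.map⁺ (All.universal (λ (a , b) → ax1 a b) pairs))
     (All.++⁺ (All.map⁺ (All.universal (λ (a , b , c) → ax2 a b c) triples))
              (All.map⁺ (All.universal (λ (a , b , c) → ax3 a b c) triples)))

    instances-true⇒ontological : ∀ {v} → All (T ∘ eval v) instances → Ontological N v
    instances-true⇒ontological ts = record
      { ax1-true = λ a b → T-⊃-elim (All.lookup (All.map⁻ ts₁) (∈-cartesianProduct⁺ a b))
      ; ax2-true = λ a b c t u → T-⊃-elim
          (All.lookup (All.map⁻ ts₂) (∈-cartesianProduct⁺ a (∈-cartesianProduct⁺ b c)))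
          (T-∧-intro t u)
      ; ax3-true = λ a b c t u → T-⊃-elim
          (All.lookup (All.map⁻ ts₃) (∈-cartesianProduct⁺ a (∈-cartesianProduct⁺ b c)))
          (T-∧-intro t u)
      }
      where
      ts₁ = All.++⁻ˡ (map Ax1 pairs) ts
      ts₂ = All.++⁻ˡ (map Ax2 triples) (All.++⁻ʳ (map Ax1 pairs) ts)
      ts₃ = All.++⁻ʳ (map Ax2 triples) (All.++⁻ʳ (map Ax1 pairs) ts)

-- The Kripke model realising a refuting valuation.

module Countermodel (p : NameVar → PropVar) (p-injective : Injective _≡_ _≡_ p)
  (N : List NameVar) (v : Kalmár.Valuation) (ontological : Kalmár.Ontological N v)
  where

  open Kalmár.Ontological ontological

  -- The value 0 outside the image of N is arbitrary.
  p⁻¹ : PropVar → NameVar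
  p⁻¹ q with any? (λ a → p a ≟ q) N
  ... | yes m = proj₁ (find m)
  ... | no  _ = 0

  p⁻¹-p : ∀ {a} → a ∈ N → p⁻¹ (p a) ≡ a
  p⁻¹-p {a} m with any? (λ a′ → p a′ ≟ p a) N
  -- The name found may differ syntactically from `a` but has the same propositional variable;
  -- injectivity identifies the two.
  ... | yes m′ = p-injective (proj₂ (proj₂ (find m′)))
  ... | no ¬m  = contradiction (lose m refl) ¬m

  leaf : NameVar → Kripke.Valuation
  leaf c q = v (c , p⁻¹ q)

  root : Kripke.Valuation
  root q = v (p⁻¹ q , p⁻¹ q)

  leaves : List Kripke.Valuation
  leaves = map leaf N

  leaf-p : ∀ {a} c → a ∈ N → leaf c (p a) ≡ v (c , a)
  leaf-p c a∈ = cong (λ a → v (c , a)) (p⁻¹-p a∈)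

  root-p : ∀ {a} → a ∈ N → root (p a) ≡ v (a , a)
  root-p a∈ = cong (λ a → v (a , a)) (p⁻¹-p a∈)

  ⊨_ : Modal.Formula → Set
  ⊨ φ = T (Kripke.eval leaves root φ)

  module _ {a b} (a∈ : a ∈ N) (b∈ : b ∈ N) where

    □⊃ : Modal.Formula
    □⊃ = Modal.□ (Modal.var (p a) Modal.⊃ Modal.var (p b))

    □⊃-intro : (∀ {c} → c ∈ N → T (v (c , a)) → T (v (c , b))) → ⊨ □⊃
    □⊃-intro h = All.all⁻ _ (All.map⁺ (All.tabulate λ {c} c∈ → T-⊃-intro λ t →
      subst T (sym (leaf-p c b∈)) (h c∈ (subst T (leaf-p c a∈) t))))

    □⊃-elim : ⊨ □⊃ → ∀ {c} → c ∈ N → T (v (c , a)) → T (v (c , b))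
    □⊃-elim t {c} c∈ u = subst T (leaf-p c b∈)
      (T-⊃-elim (All.lookup (All.map⁻ (All.all⁺ _ leaves t)) c∈) (subst T (sym (leaf-p c a∈)) u))

  -- Ax1 gives p_a at the root and Ax2 the inclusion at each leaf. For the last clause, p_b at the
  -- root means v b b, so Ax3 turns v a b into v b a, and Ax2 carries v c b to v c a.
  B-ε-true : ∀ {a b} → a ∈ N → b ∈ N → T (v (a , b)) → ⊨ B p (L₁.ε a b)
  B-ε-true {a} {b} a∈ b∈ ab = T-∧-intro (subst T (sym (root-p a∈)) (ax1-true a∈ b∈ ab))
    (T-∧-intro (□⊃-intro a∈ b∈ λ c∈ ca → ax2-true c∈ a∈ b∈ ca ab)
      (T-⊃-intro λ t → □⊃-intro b∈ a∈ λ c∈ cb →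
        ax2-true c∈ b∈ a∈ cb (ax3-true a∈ b∈ b∈ ab (subst T (root-p b∈) t))))

  -- The leaf contributed by `a` decides: p_a at the root means v a a, so p_a holds at that leaf,
  -- and the boxed inclusion gives p_b there, which is v a b.
  B-ε-true⁻¹ : ∀ {a b} → a ∈ N → b ∈ N → ⊨ B p (L₁.ε a b) → T (v (a , b))
  B-ε-true⁻¹ a∈ b∈ t with T-∧-elim t
  ... | pa , u = □⊃-elim a∈ b∈ (proj₁ (T-∧-elim u)) a∈ (subst T (root-p a∈) pa)

  eval-B : ∀ φ → (∀ {a b} → (a , b) ∈ Kalmár.atoms φ → a ∈ N × b ∈ N) →
    Kripke.eval leaves root (B p φ) ≡ Kalmár.eval v φ
  eval-B (L₁.ε a b)  h with h (here refl)
  ... | a∈ , b∈ = T-⇔⇒≡ (B-ε-true⁻¹ a∈ b∈) (B-ε-true a∈ b∈)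
  eval-B (φ L₁.∨ ψ) h =
    cong₂ _∨ᵇ_ (eval-B φ (h ∘ ∈-++⁺ˡ)) (eval-B ψ (h ∘ ∈-++⁺ʳ (Kalmár.atoms φ)))
  eval-B (L₁.¬ φ)   h = cong not (eval-B φ h)

-- The embedding theorem.

B-reflects-⊢ : (p : NameVar → PropVar) → Injective _≡_ _≡_ p →
  ∀ φ → PrL.⊢ B p φ → L₁.⊢ φ
B-reflects-⊢ p p-injective φ d =
  case ⊢⊎refutable-in φ (instances-provable names) of λ where
    (inj₁ e) → e
    (inj₂ (v , ts , φ-false)) →
      -- Soundness makes `B p φ` true at the root, whereas `eval-B` gives it the value of `φ` under
      -- `v`, which is false.
      let open Countermodel p p-injective names v (instances-true⇒ontological names ts)
      in ⊥-elim (subst T (trans (eval-B φ λ m → ∈-++⁺ˡ (∈-map⁺ proj₁ m) , ∈-++⁺ʳ _ (∈-map⁺ proj₂ m)) φ-false)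
                         (Kripke.sound d leaves root))
  where
  open Kalmár
  names : List NameVar
  names = map proj₁ (atoms φ) ++ map proj₂ (atoms φ)

corollary6p6 : (p : NameVar → PropVar) → Injective _≡_ _≡_ p →
    (φ : L₁.Formula) → (L₁.⊢ φ) ⇔ (PrL.⊢ (B p φ))
corollary6p6 p p-injective φ =
  mk⇔ (Translation.B-preserves-⊢ p) (B-reflects-⊢ p p-injective φ)
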